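{- Let $c>0$. Let $G$ be an $n$-vertex even-hole-free graph with $\alpha(G)=cn$, where $n$ is sufficiently large. Then $h(G)\le \frac{5n}{\log n}$.
   Context: All graphs are finite and simple; $\log$ is base $2$. $\alpha(G)$ is the independence number. A hitting set of $G$ is a set $T\subseteq V(G)$ meeting every maximum independent set of $G$; $h(G)$ is the minimum size of a hitting set. A hole is an induced cycle of length at least $4$; it is even if it has an even number of vertices; a graph is even-hole-free if it has no even hole. -}

module Defs where

open import Data.Nat using (ℕ; zero; suc; _≤_; _+_)
open import Data.Bool using (Bool; true; false)
open import Data.Fin using (Fin; toℕ)
open import Data.Fin.Subset using (Subset; _∈_; ∣_∣)
open import Data.Product using (Σ; _×_; ∃)
open import Data.Sum using (_⊎_)
open import Relation.Binary.PropositionalEquality using (_≡_)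
open import Function.Definitions using (Injective)
open import Function.Bundles using (_⇔_)
open import Data.Nat.Divisibility using (_∣_)

record Graph (n : ℕ) : Set where
  field
    adj   : Fin n → Fin n → Bool
    sym   : ∀ x y → adj x y ≡ adj y x
    irrefl : ∀ x → adj x x ≡ false
open Graph public

Adj : ∀ {n} → Graph n → Fin n → Fin n → Set
Adj G x y = adj G x y ≡ true

CycAdj : (k : ℕ) → Fin k → Fin k → Set
CycAdj k i j =
  (suc (toℕ i) ≡ toℕ j) ⊎ (suc (toℕ j) ≡ toℕ i)
  ⊎ ((toℕ i ≡ 0) × (suc (toℕ j) ≡ k)) ⊎ ((toℕ j ≡ 0) × (suc (toℕ i) ≡ k))

IsHole : ∀ {n} → Graph n → (k : ℕ) → (Fin k → Fin n) → Set
IsHole G k v = (4 ≤ k) × Injective _≡_ _≡_ v × (∀ i j → Adj G (v i) (v j) ⇔ CycAdj k i j)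

EvenHoleFree : ∀ {n} → Graph n → Set
EvenHoleFree {n} G = ∀ (k : ℕ) (v : Fin k → Fin n) → 2 ∣ k → IsHole G k v → Data.Empty.⊥
  where import Data.Empty

Independent : ∀ {n} → Graph n → Subset n → Set
Independent G S = ∀ x y → x ∈ S → y ∈ S → adj G x y ≡ false

MaxIndependent : ∀ {n} → Graph n → Subset n → Set
MaxIndependent {n} G S = Independent G S × (∀ (S′ : Subset n) → Independent G S′ → ∣ S′ ∣ ≤ ∣ S ∣)

IndependenceNumber : ∀ {n} → Graph n → ℕ → Set
IndependenceNumber {n} G k = Σ (Subset n) λ S → MaxIndependent G S × (∣ S ∣ ≡ k)

HittingSet : ∀ {n} → Graph n → Subset n → Set
HittingSet {n} G T = ∀ (S : Subset n) → MaxIndependent G S → ∃ λ x → (x ∈ T) × (x ∈ S)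

{-# OPTIONS --safe #-}
module Submission where

-- Let A be a nonempty independent set and U(A) the set of vertices with exactly one neighbour in
-- A. Then A ∪ U(A) is a hitting set: if a maximum independent set J misses it, every vertex of
-- K = J ∩ N(A) has two neighbours in A, and ∣K∣ ≥ ∣A∣ by maximality of J. Deleting vertices of A
-- with at most one neighbour in K, together with that neighbour, preserves this situation, so we
-- reach a bipartite graph of minimum degree two. A longest induced path in it closes up to a hole,
-- which is even.
--
-- To make U(A) small, start with 2^k ≈ √n vertices of a maximum independent set and halve
-- repeatedly. A vertex of U(A) has no neighbour in one of the two halves of A, so for one half A′
-- we get 2∣N(A′)∣ + ∣U(A)∣ ≤ 2∣N(A)∣. Since N never exceeds n vertices, some set on the way has
-- ∣U(A)∣ (k + 2) ≤ 2n, which is about 4n / log n.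

open import Defs
open import Data.Nat using (ℕ; suc; _≤_; _*_; _^_)
open import Data.Fin.Subset using (Subset; ∣_∣)
open import Data.Product using (Σ; _×_; ∃)
open import Relation.Binary.PropositionalEquality using (_≡_)

open import Data.Bool using (Bool; true; false; not)
open import Data.Bool.Properties using (not-involutive; not-¬) renaming (_≟_ to _≟ᵇ_)
open import Data.Empty using (⊥; ⊥-elim)
open import Data.Fin using (Fin; zero; suc; toℕ; _≟_)
open import Data.Fin.Properties using (any?; all?; injective⇒≤)
open import Data.Fin.Subset using (_∈_; _∉_; _⊆_; _∪_; _∩_; _─_; _-_; ⁅_⁆; Nonempty; inside; outside)
open import Data.Fin.Subset.Properties
open import Data.List using (List; []; _∷_; length; take; lookup)
open import Data.List.Membership.Propositional.Properties using (∈-lookup)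
open import Data.List.Relation.Unary.All as All using (All; []; _∷_)
open import Data.List.Relation.Unary.All.Properties using (¬Any⇒All¬) renaming (take⁺ to All-take⁺)
open import Data.List.Relation.Unary.AllPairs using ([]; _∷_)
open import Data.List.Relation.Unary.Any as Any using (Any; here; there)
open import Data.List.Relation.Unary.Unique.Propositional using (Unique)
open import Data.List.Relation.Unary.Unique.Propositional.Properties using () renaming (take⁺ to Unique-take⁺)
open import Data.Nat using (zero; _+_; _∸_; _<_; z≤n; s≤s; s≤s⁻¹)
open import Data.Nat.Divisibility using (_∣_; ∣-refl; ∣m∣n⇒∣m+n; ∣⇒≤)
open import Data.Nat.Properties hiding (_≟_)
open import Data.Product using (_,_; proj₁)
open import Data.Sum using (_⊎_; inj₁; inj₂; [_,_]′)
import Data.Sum as Sum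
open import Data.Vec using ([]; _∷_; here; there; tabulate)
open import Data.Vec.Properties using (lookup∘tabulate; lookup⇒[]=; []=⇒lookup)
open import Function using (_∘_; id)
open import Function.Bundles using (_⇔_; mk⇔; Equivalence)
open import Function.Definitions using (Injective)
open import Relation.Binary.PropositionalEquality using (_≢_; refl; trans; cong; subst; module ≡-Reasoning) renaming (sym to ≡-sym)
open import Relation.Nullary using (¬_; Dec; yes; no; does; contradiction)
open import Relation.Nullary.Decidable using (_×-dec_; _→-dec_; ¬?; dec-true; dec-false; decidable-stable)
open import Level using (0ℓ)
open import Relation.Unary using (Pred; Decidable)

private
  variable
    n : ℕ
    p : Subset n

-- Cardinalities of subsets

∣p∪q∣+∣p∩q∣≡∣p∣+∣q∣ : (p q : Subset n) → ∣ p ∪ q ∣ + ∣ p ∩ q ∣ ≡ ∣ p ∣ + ∣ q ∣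
∣p∪q∣+∣p∩q∣≡∣p∣+∣q∣ []            []            = refl
∣p∪q∣+∣p∩q∣≡∣p∣+∣q∣ (outside ∷ p) (outside ∷ q) = ∣p∪q∣+∣p∩q∣≡∣p∣+∣q∣ p q
∣p∪q∣+∣p∩q∣≡∣p∣+∣q∣ (inside  ∷ p) (outside ∷ q) = cong suc (∣p∪q∣+∣p∩q∣≡∣p∣+∣q∣ p q)
∣p∪q∣+∣p∩q∣≡∣p∣+∣q∣ (outside ∷ p) (inside  ∷ q) =
  trans (cong suc (∣p∪q∣+∣p∩q∣≡∣p∣+∣q∣ p q)) (≡-sym (+-suc _ _))
∣p∪q∣+∣p∩q∣≡∣p∣+∣q∣ (inside  ∷ p) (inside  ∷ q) = cong suc
  (trans (+-suc _ _) (trans (cong suc (∣p∪q∣+∣p∩q∣≡∣p∣+∣q∣ p q)) (≡-sym (+-suc _ _))))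

∣p─q∣+∣p∩q∣≡∣p∣ : (p q : Subset n) → ∣ p ─ q ∣ + ∣ p ∩ q ∣ ≡ ∣ p ∣
∣p─q∣+∣p∩q∣≡∣p∣ []            []            = refl
∣p─q∣+∣p∩q∣≡∣p∣ (outside ∷ p) (outside ∷ q) = ∣p─q∣+∣p∩q∣≡∣p∣ p q
∣p─q∣+∣p∩q∣≡∣p∣ (outside ∷ p) (inside  ∷ q) = ∣p─q∣+∣p∩q∣≡∣p∣ p q
∣p─q∣+∣p∩q∣≡∣p∣ (inside  ∷ p) (outside ∷ q) = cong suc (∣p─q∣+∣p∩q∣≡∣p∣ p q)
∣p─q∣+∣p∩q∣≡∣p∣ (inside  ∷ p) (inside  ∷ q) = trans (+-suc _ _) (cong suc (∣p─q∣+∣p∩q∣≡∣p∣ p q))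

x∈p─q⇒x∉q : ∀ {x} (p q : Subset n) → x ∈ p ─ q → x ∉ q
x∈p─q⇒x∉q (inside ∷ p) (outside ∷ q) here      ()
x∈p─q⇒x∉q (_ ∷ p)      (inside  ∷ q) (there i) (there j) = x∈p─q⇒x∉q p q i j
x∈p─q⇒x∉q (_ ∷ p)      (outside ∷ q) (there i) (there j) = x∈p─q⇒x∉q p q i j

∣p∪q∣≤∣p∣+∣q∣ : (p q : Subset n) → ∣ p ∪ q ∣ ≤ ∣ p ∣ + ∣ q ∣
∣p∪q∣≤∣p∣+∣q∣ p q = ≤-trans (m≤m+n _ _) (≤-reflexive (∣p∪q∣+∣p∩q∣≡∣p∣+∣q∣ p q))

∣p∣≤1+∣p-x∣ : (p : Subset n) (x : Fin n) → ∣ p ∣ ≤ suc ∣ p - x ∣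
∣p∣≤1+∣p-x∣ p x = begin
  ∣ p ∣                         ≡⟨ ∣p─q∣+∣p∩q∣≡∣p∣ p ⁅ x ⁆ ⟨
  ∣ p - x ∣ + ∣ p ∩ ⁅ x ⁆ ∣     ≤⟨ +-monoʳ-≤ _ (∣p∩q∣≤∣q∣ p ⁅ x ⁆) ⟩
  ∣ p - x ∣ + ∣ ⁅ x ⁆ ∣         ≡⟨ cong (∣ p - x ∣ +_) (∣⁅x⁆∣≡1 x) ⟩
  ∣ p - x ∣ + 1                 ≡⟨ +-comm _ 1 ⟩
  suc ∣ p - x ∣                 ∎
  where open ≤-Reasoning

x∈p-y⇒x≢y : ∀ {x y} (p : Subset n) → x ∈ p - y → x ≢ y
x∈p-y⇒x≢y {y = y} p x∈ refl = x∈p─q⇒x∉q p ⁅ y ⁆ x∈ (x∈⁅x⁆ y)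

0<∣p∣⇒Nonempty : (p : Subset n) → 0 < ∣ p ∣ → Nonempty p
0<∣p∣⇒Nonempty (inside  ∷ p) _  = zero , here
0<∣p∣⇒Nonempty (outside ∷ p) lt with 0<∣p∣⇒Nonempty p lt
... | x , x∈p = suc x , there x∈p

Nonempty⇒0<∣p∣ : Nonempty p → 0 < ∣ p ∣
Nonempty⇒0<∣p∣ {p = p} (x , x∈p) = ≤-<-trans z≤n (x∈p⇒∣p-x∣<∣p∣ x∈p)

subset-of-size : ∀ (p : Subset n) s → s ≤ ∣ p ∣ → ∃ λ r → r ⊆ p × ∣ r ∣ ≡ s
subset-of-size []            zero    _  = [] , id , refl
subset-of-size (outside ∷ p) s       le with subset-of-size p s le
... | r , r⊆p , eq = outside ∷ r , s⊆s r⊆p , eq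
subset-of-size (inside ∷ p)  zero    _  with subset-of-size p zero z≤n
... | r , r⊆p , eq = outside ∷ r , out⊆ r⊆p , eq
subset-of-size (inside ∷ p)  (suc s) le with subset-of-size p s (s≤s⁻¹ le)
... | r , r⊆p , eq = inside ∷ r , s⊆s r⊆p , cong suc eq

module _ {P : Pred (Fin n) 0ℓ} (P? : Decidable P) where

  comprehension : Subset n
  comprehension = tabulate (does ∘ P?)

  comprehension⁺ : ∀ {x} → P x → x ∈ comprehension
  comprehension⁺ {x} px = lookup⇒[]= x _ (trans (lookup∘tabulate _ x) (dec-true (P? x) px))

  comprehension⁻ : ∀ {x} → x ∈ comprehension → P x
  comprehension⁻ {x} x∈ with P? x in eq
  ... | yes px = px
  ... | no  _  = contradiction
    (trans (≡-sym (cong does eq)) (trans (≡-sym (lookup∘tabulate _ x)) ([]=⇒lookup x∈))) λ ()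

lookup-injective : ∀ {A : Set} {xs : List A} → Unique xs → Injective _≡_ _≡_ (lookup xs)
lookup-injective (_  ∷ _) {zero}  {zero}  _  = refl
lookup-injective (px ∷ _) {zero}  {suc j} eq = contradiction eq (All.lookup px (∈-lookup j))
lookup-injective (px ∷ _) {suc i} {zero}  eq = contradiction (≡-sym eq) (All.lookup px (∈-lookup i))
lookup-injective (_  ∷ u) {suc i} {suc j} eq = cong suc (lookup-injective u eq)

module _ (G : Graph n) where

  private
    _~_ : Fin n → Fin n → Set
    _~_ = Adj G

  ~-sym : ∀ {x y} → x ~ y → y ~ x
  ~-sym {x} {y} = trans (sym G y x)

  ~-irrefl : ∀ {x} → ¬ x ~ x
  ~-irrefl {x} e = contradiction (trans (≡-sym e) (irrefl G x)) λ ()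

  ~⇒≢ : ∀ {x y} → x ~ y → x ≢ y
  ~⇒≢ e refl = ~-irrefl e

  _~?_ : ∀ x y → Dec (x ~ y)
  x ~? y = adj G x y ≟ᵇ true

  independent⇒≁ : ∀ {S x y} → Independent G S → x ∈ S → y ∈ S → ¬ x ~ y
  independent⇒≁ ind x∈S y∈S e = contradiction (trans (≡-sym e) (ind _ _ x∈S y∈S)) λ ()

  independent-⊆ : ∀ {S S′} → S′ ⊆ S → Independent G S → Independent G S′
  independent-⊆ S′⊆S ind x y x∈ y∈ = ind x y (S′⊆S x∈) (S′⊆S y∈)

  -- Induced paths and holes

  -- Distinctness is not built in: `x`, `y`, `x` qualifies whenever `x ~ y`. Hence `Unique` is
  -- required separately when a hole is formed.
  data InducedPath : List (Fin n) → Set where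
    single : ∀ x → InducedPath (x ∷ [])
    link   : ∀ {x y ys} → x ~ y → All (λ z → ¬ x ~ z) ys →
             InducedPath (y ∷ ys) → InducedPath (x ∷ y ∷ ys)

  data OnlyLastAdj (w : Fin n) : List (Fin n) → Set where
    last : ∀ {z} → w ~ z → OnlyLastAdj w (z ∷ [])
    skip : ∀ {y ys} → ¬ w ~ y → OnlyLastAdj w ys → OnlyLastAdj w (y ∷ ys)

  InducedPath-take : ∀ {x xs} k → InducedPath (x ∷ xs) → InducedPath (x ∷ take k xs)
  InducedPath-take zero    _               = single _
  InducedPath-take (suc k) (single x)      = single x
  InducedPath-take (suc k) (link xy far ip) = link xy (All-take⁺ k far) (InducedPath-take k ip)

  -- Cutting at the first neighbour of `w` leaves `w` without chords into the prefix, which makes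
  -- the cycle closed through `w` induced.
  take-to-first-nbr : ∀ {w xs} → Any (w ~_) xs → ∃ λ k → OnlyLastAdj w (take k xs)
  take-to-first-nbr {w} {x ∷ xs} any with w ~? x | any
  ... | yes wx | _         = 1 , last wx
  ... | no ¬wx | here wx   = contradiction wx ¬wx
  ... | no ¬wx | there any′ with take-to-first-nbr any′
  ...   | k , ola = suc k , skip ¬wx ola

  PathAdj : ∀ {k} → Fin k → Fin k → Set
  PathAdj i j = (suc (toℕ i) ≡ toℕ j) ⊎ (suc (toℕ j) ≡ toℕ i)

  path-adjacency : ∀ {xs} → InducedPath xs → ∀ i j → lookup xs i ~ lookup xs j ⇔ PathAdj i j
  path-adjacency (single x) zero zero = mk⇔ (⊥-elim ∘ ~-irrefl) λ { (inj₁ ()) ; (inj₂ ()) }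
  path-adjacency (link xy far ip) zero zero = mk⇔ (⊥-elim ∘ ~-irrefl) λ { (inj₁ ()) ; (inj₂ ()) }
  path-adjacency (link xy far ip) zero (suc zero) = mk⇔ (λ _ → inj₁ refl) (λ _ → xy)
  path-adjacency (link xy far ip) zero (suc (suc j)) =
    mk⇔ (⊥-elim ∘ All.lookup far (∈-lookup j)) λ { (inj₁ ()) ; (inj₂ ()) }
  path-adjacency (link xy far ip) (suc zero) zero = mk⇔ (λ _ → inj₂ refl) (λ _ → ~-sym xy)
  path-adjacency (link xy far ip) (suc (suc i)) zero =
    mk⇔ (⊥-elim ∘ All.lookup far (∈-lookup i) ∘ ~-sym) λ { (inj₁ ()) ; (inj₂ ()) }
  path-adjacency (link xy far ip) (suc i) (suc j) = mk⇔
    (Sum.map (cong suc) (cong suc) ∘ Equivalence.to (path-adjacency ip i j))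
    (Equivalence.from (path-adjacency ip i j) ∘ Sum.map suc-injective suc-injective)

  onlyLast-adjacency : ∀ {w xs} → OnlyLastAdj w xs → ∀ j → w ~ lookup xs j ⇔ suc (toℕ j) ≡ length xs
  onlyLast-adjacency (last wz)              zero    = mk⇔ (λ _ → refl) (λ _ → wz)
  onlyLast-adjacency (skip ¬wy (last _))    zero    = mk⇔ (⊥-elim ∘ ¬wy) λ ()
  onlyLast-adjacency (skip ¬wy (skip _ _))  zero    = mk⇔ (⊥-elim ∘ ¬wy) λ ()
  onlyLast-adjacency (skip ¬wy ola)         (suc j) = mk⇔
    (cong suc ∘ Equivalence.to (onlyLast-adjacency ola j))
    (Equivalence.from (onlyLast-adjacency ola j) ∘ suc-injective)

  -- The cycle runs through `w`, `x` and `xs` in this order. `OnlyLastAdj` supplies the wrap-around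
  -- edge and excludes every other edge from `w` to `xs`; the length bound rules out a triangle.
  close-path : ∀ {w x xs} → 2 ≤ length xs → w ~ x → InducedPath (x ∷ xs) → OnlyLastAdj w xs →
               Unique (w ∷ x ∷ xs) → IsHole G (length (w ∷ x ∷ xs)) (lookup (w ∷ x ∷ xs))
  close-path {w} {x} {xs} 2≤ wx ip ola uniq = s≤s (s≤s 2≤) , lookup-injective uniq , cyc
    where
    cyc : ∀ i j → lookup (w ∷ x ∷ xs) i ~ lookup (w ∷ x ∷ xs) j ⇔ CycAdj (length (w ∷ x ∷ xs)) i j
    cyc zero zero = mk⇔ (⊥-elim ∘ ~-irrefl)
      λ { (inj₁ ()) ; (inj₂ (inj₁ ())) ; (inj₂ (inj₂ (inj₁ ()))) ; (inj₂ (inj₂ (inj₂ ()))) }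
    cyc zero (suc zero) = mk⇔ (λ _ → inj₁ refl) (λ _ → wx)
    cyc zero (suc (suc j)) = mk⇔
      (λ e → inj₂ (inj₂ (inj₁ (refl , cong (λ m → 2 + m) (Equivalence.to (onlyLast-adjacency ola j) e)))))
      λ { (inj₂ (inj₂ (inj₁ (_ , e)))) →
            Equivalence.from (onlyLast-adjacency ola j) (suc-injective (suc-injective e))
        ; (inj₁ ()) ; (inj₂ (inj₁ ())) ; (inj₂ (inj₂ (inj₂ (() , _)))) }
    cyc (suc zero) zero = mk⇔ (λ _ → inj₂ (inj₁ refl)) (λ _ → ~-sym wx)
    cyc (suc (suc i)) zero = mk⇔
      (λ e → inj₂ (inj₂ (inj₂ (refl , cong (λ m → 2 + m) (Equivalence.to (onlyLast-adjacency ola i) (~-sym e))))))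
      λ { (inj₂ (inj₂ (inj₂ (_ , e)))) →
            ~-sym (Equivalence.from (onlyLast-adjacency ola i) (suc-injective (suc-injective e)))
        ; (inj₁ ()) ; (inj₂ (inj₁ ())) ; (inj₂ (inj₂ (inj₁ (() , _)))) }
    cyc (suc i) (suc j) = mk⇔
      ([ inj₁ ∘ cong suc , inj₂ ∘ inj₁ ∘ cong suc ]′ ∘ Equivalence.to (path-adjacency ip i j))
      λ { (inj₁ e)        → Equivalence.from (path-adjacency ip i j) (inj₁ (suc-injective e))
        ; (inj₂ (inj₁ e)) → Equivalence.from (path-adjacency ip i j) (inj₂ (suc-injective e))
        ; (inj₂ (inj₂ (inj₁ (() , _)))) ; (inj₂ (inj₂ (inj₂ (() , _)))) }

  -- Bipartite induced subgraphs of minimum degree two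

  module _ (ehf : EvenHoleFree G) {S : Pred (Fin n) 0ℓ} (colour : Fin n → Bool)
           (proper : ∀ {x y} → S x → S y → x ~ y → colour x ≡ not (colour y))
           -- Degree at least two without counting: if `u` is one neighbour, then `w` is a second.
           (another-nbr : ∀ {x} → S x → ∀ u → ∃ λ w → S w × w ~ x × w ≢ u) where

    -- Colours alternate along the path and its last vertex is adjacent to `w`, so the colour of the
    -- first vertex decides the parity of the length. Passing to the tail swaps the two cases, so
    -- they are proved together.
    parity : ∀ {w x xs} → S w → All S (x ∷ xs) → InducedPath (x ∷ xs) → OnlyLastAdj w (x ∷ xs) →
             (colour x ≡ colour w → 2 ∣ length (x ∷ xs)) ×
             (colour x ≡ not (colour w) → 2 ∣ suc (length (x ∷ xs)))
    parity Sw (Sx ∷ _) (single x) (last wx) =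
      (λ e → contradiction (proper Sx Sw (~-sym wx)) (not-¬ e)) , λ _ → ∣-refl
    parity Sw (Sx ∷ Sy ∷ Sys) (link xy _ ip) (skip _ ola) with parity Sw (Sy ∷ Sys) ip ola
    ... | even , odd =
      (λ e → odd (trans (proper Sy Sx (~-sym xy)) (cong not e))) ,
      (λ e → ∣m∣n⇒∣m+n ∣-refl (even (trans (proper Sy Sx (~-sym xy)) (trans (cong not e) (not-involutive _)))))

    -- Take a neighbour `w` of the head other than `y`. An edge `w ~ y` would close a triangle with
    -- `x`, impossible in a 2-coloured graph; and `w` is not in `ys` because `x` has no neighbour
    -- there.
    fresh-nbr : ∀ {x y ys} → InducedPath (x ∷ y ∷ ys) → All S (x ∷ y ∷ ys) →
                ∃ λ w → S w × w ~ x × ¬ w ~ y × All (w ≢_) (x ∷ y ∷ ys)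
    fresh-nbr {x} {y} {ys} (link xy far _) (Sx ∷ Sy ∷ _) with another-nbr Sx y
    ... | w , Sw , wx , w≢y =
      w , Sw , wx ,
      (λ wy → not-¬ (trans (proper Sx Sy xy) (≡-sym (proper Sw Sy wy))) (proper Sx Sw (~-sym wx))) ,
      ~⇒≢ wx ∷ w≢y ∷ All.map (λ { x≁z refl → x≁z (~-sym wx) }) far

    -- In place of a longest path, a path is grown at its head until it closes up. Each extension
    -- uses one unit of `fuel`; when none is left, the path has `suc n` distinct vertices among `n`.
    extend-path : ∀ fuel {x y ys} → length (x ∷ y ∷ ys) + fuel ≡ suc n →
                  InducedPath (x ∷ y ∷ ys) → Unique (x ∷ y ∷ ys) → All S (x ∷ y ∷ ys) → ⊥
    extend-path zero eq ip uniq Sxs =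
      <⇒≱ ≤-refl (subst (_≤ n) (trans (≡-sym (+-identityʳ _)) eq) (injective⇒≤ (lookup-injective uniq)))
    extend-path (suc fuel) {x} {y} {ys} eq ip@(link xy _ ip′) uniq Sxs@(Sx ∷ Sy ∷ Sys)
      with fresh-nbr ip Sxs
    ... | w , Sw , wx , w≁y , w∉xs with Any.any? (w ~?_) ys
    ...   | no ¬any = extend-path fuel (trans (≡-sym (+-suc _ fuel)) eq)
              (link wx (w≁y ∷ ¬Any⇒All¬ ys ¬any) ip) (w∉xs ∷ uniq) (Sw ∷ Sxs)
    ...   | yes any with take-to-first-nbr any
    -- The hole is `w`, `x` and then `y ∷ take k ys`. The latter has even length and is nonempty, so
    -- it has the two entries that `close-path` asks for.
    ...     | k , ola = ehf _ _ (∣m∣n⇒∣m+n ∣-refl even)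
              (close-path (∣⇒≤ even) wx (InducedPath-take (suc k) ip) (skip w≁y ola)
                (Unique-take⁺ (3 + k) (w∉xs ∷ uniq)))
      where
      even : 2 ∣ length (y ∷ take k ys)
      -- Both `y` and `w` are adjacent to `x`, so they share a colour.
      even = proj₁ (parity Sw (Sy ∷ All-take⁺ k Sys) (InducedPath-take k ip′) (skip w≁y ola))
                   (trans (proper Sy Sx (~-sym xy)) (≡-sym (proper Sw Sx wx)))

    no-min-degree-two : ∀ {x} → ¬ S x
    no-min-degree-two {x} Sx with another-nbr Sx x
    ... | y , Sy , yx , y≢x = extend-path (n ∸ 1) (start x)
            (link yx [] (single x)) ((y≢x ∷ []) ∷ [] ∷ []) (Sy ∷ Sx ∷ [])
      where
      -- A vertex exists, so `n` is positive and `n ∸ 1` does not truncate.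
      start : Fin n → 2 + (n ∸ 1) ≡ suc n
      start zero    = refl
      start (suc _) = refl

  -- Reduction to minimum degree two

  Thick : Subset n → Subset n → Set
  Thick A K = ∀ {v} → v ∈ K → ∀ u → ∃ λ w → (w ∈ A × w ~ v) × w ≢ u

  -- Induction on a bound for `∣ A ∣`. Deletion stops when the vertices of `A` also have two
  -- neighbours in `K`; then `A` and `K` are the colour classes for `no-min-degree-two`. Carrying
  -- `∣ A ∣ ≤ ∣ K ∣` along keeps `K` nonempty, and thickness then keeps `A` nonempty after a
  -- deletion.
  no-thick-pair : EvenHoleFree G → ∀ m {A K} → ∣ A ∣ ≤ m → Independent G A → Independent G K →
                  (∀ {x} → x ∈ A → x ∉ K) → Nonempty A → ∣ A ∣ ≤ ∣ K ∣ → ¬ Thick A K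
  no-thick-pair ehf zero ∣A∣≤0 _ _ _ A≠∅ _ _ = <⇒≱ (Nonempty⇒0<∣p∣ A≠∅) ∣A∣≤0
  no-thick-pair ehf (suc m) {A} {K} ∣A∣≤ indA indK A∌K A≠∅@(a , a∈A) A≤K thick
    -- A vertex `x` without neighbours in `K` passes this test with any `u`, so `u` may lie outside
    -- `K`.
    with any? (λ x → x ∈? A ×-dec any? (λ u → all? (λ w → (w ∈? K ×-dec w ~? x) →-dec w ≟ u)))
  ... | yes (x , x∈A , u , only-u) = no-thick-pair ehf m {A - x} {K - u}
          (s≤s⁻¹ (≤-trans (x∈p⇒∣p-x∣<∣p∣ x∈A) ∣A∣≤))
          (independent-⊆ (p─q⊆p A _) indA) (independent-⊆ (p─q⊆p K _) indK)
          (λ y∈A y∈K → A∌K (p─q⊆p A _ y∈A) (p─q⊆p K _ y∈K))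
          nonempty
          -- `A` loses a vertex and `K` at most one, so the inequality survives.
          (s≤s⁻¹ (≤-trans (x∈p⇒∣p-x∣<∣p∣ x∈A) (≤-trans A≤K (∣p∣≤1+∣p-x∣ K u))))
          thick′
    where
    nonempty : Nonempty (A - x)
    nonempty with 0<∣p∣⇒Nonempty K (≤-trans (Nonempty⇒0<∣p∣ A≠∅) A≤K)
    ... | v , v∈K with thick v∈K x
    ...   | w , (w∈A , _) , w≢x = w , x∈p∧x≢y⇒x∈p-y w∈A w≢x
    thick′ : Thick (A - x) (K - u)
    thick′ {v} v∈K-u u′ with thick (p─q⊆p K _ v∈K-u) u′
    ... | w , (w∈A , wv) , w≢u′ = w , (x∈p∧x≢y⇒x∈p-y w∈A w≢x , wv) , w≢u′
      where
      -- The only possible neighbour of `x` in `K` was `u`, which has been removed.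
      w≢x : w ≢ x
      w≢x refl = x∈p-y⇒x≢y K v∈K-u (only-u v (p─q⊆p K _ v∈K-u , ~-sym wv))
  ... | no ¬thin = no-min-degree-two ehf {λ x → x ∈ A ⊎ x ∈ K} (λ x → does (x ∈? A))
                     proper another-nbr (inj₁ a∈A)
    where
    proper : ∀ {x y} → x ∈ A ⊎ x ∈ K → y ∈ A ⊎ y ∈ K → x ~ y → does (x ∈? A) ≡ not (does (y ∈? A))
    proper (inj₁ x∈A) (inj₁ y∈A) e = contradiction e (independent⇒≁ indA x∈A y∈A)
    proper (inj₂ x∈K) (inj₂ y∈K) e = contradiction e (independent⇒≁ indK x∈K y∈K)
    proper {x} {y} (inj₁ x∈A) (inj₂ y∈K) _ =
      trans (dec-true (x ∈? A) x∈A) (cong not (≡-sym (dec-false (y ∈? A) λ y∈A → A∌K y∈A y∈K)))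
    proper {x} {y} (inj₂ x∈K) (inj₁ y∈A) _ =
      trans (dec-false (x ∈? A) λ x∈A → A∌K x∈A x∈K) (cong not (≡-sym (dec-true (y ∈? A) y∈A)))
    another-nbr : ∀ {x} → x ∈ A ⊎ x ∈ K → ∀ u → ∃ λ w → (w ∈ A ⊎ w ∈ K) × w ~ x × w ≢ u
    another-nbr (inj₂ x∈K) u with thick x∈K u
    ... | w , (w∈A , wx) , w≢u = w , inj₁ w∈A , wx , w≢u
    another-nbr {x} (inj₁ x∈A) u
      with any? (λ w → (w ∈? K ×-dec w ~? x) ×-dec ¬? (w ≟ u))
    ... | yes (w , (w∈K , wx) , w≢u) = w , inj₂ w∈K , wx , w≢u
    ... | no  ¬w = contradiction
      (x , x∈A , u , λ w wKx → decidable-stable (w ≟ u) λ w≢u → ¬w (w , wKx , w≢u)) ¬thin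

  -- Private neighbours and hitting sets

  HasNbrIn : Subset n → Pred (Fin n) 0ℓ
  HasNbrIn A v = ∃ λ x → x ∈ A × x ~ v

  HasUniqueNbrIn : Subset n → Pred (Fin n) 0ℓ
  HasUniqueNbrIn A v = ∃ λ x → (x ∈ A × x ~ v) × (∀ y → y ∈ A × y ~ v → y ≡ x)

  hasNbrIn? : ∀ A → Decidable (HasNbrIn A)
  hasNbrIn? A v = any? λ x → x ∈? A ×-dec x ~? v

  hasUniqueNbrIn? : ∀ A → Decidable (HasUniqueNbrIn A)
  hasUniqueNbrIn? A v =
    any? λ x → (x ∈? A ×-dec x ~? v) ×-dec all? λ y → (y ∈? A ×-dec y ~? v) →-dec y ≟ x

  nbrs uniqueNbrs : Subset n → Subset n
  nbrs A       = comprehension (hasNbrIn? A)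
  uniqueNbrs A = comprehension (hasUniqueNbrIn? A)

  -- If this failed, (J ─ nbrs A) ∪ A would be a larger independent set.
  ∣A∣≤∣J∩nbrs∣ : ∀ {A J} → Independent G A → MaxIndependent G J → (∀ {x} → x ∈ A → x ∉ J) →
                 ∣ A ∣ ≤ ∣ J ∩ nbrs A ∣
  ∣A∣≤∣J∩nbrs∣ {A} {J} indA (indJ , maxJ) A∌J = +-cancelˡ-≤ ∣ J ─ nbrs A ∣ _ _ (begin
    ∣ J ─ nbrs A ∣ + ∣ A ∣                            ≡⟨ ∣p∪q∣+∣p∩q∣≡∣p∣+∣q∣ (J ─ nbrs A) A ⟨
    ∣ (J ─ nbrs A) ∪ A ∣ + ∣ (J ─ nbrs A) ∩ A ∣      ≤⟨ +-mono-≤ (maxJ _ indJ′) (≮⇒≥ (disjoint ∘ 0<∣p∣⇒Nonempty _)) ⟩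
    ∣ J ∣ + 0                                         ≡⟨ +-identityʳ _ ⟩
    ∣ J ∣                                             ≡⟨ ∣p─q∣+∣p∩q∣≡∣p∣ J (nbrs A) ⟨
    ∣ J ─ nbrs A ∣ + ∣ J ∩ nbrs A ∣                   ∎)
    where
    open ≤-Reasoning
    disjoint : ¬ Nonempty ((J ─ nbrs A) ∩ A)
    disjoint (x , x∈) with x∈p∩q⁻ (J ─ nbrs A) A x∈
    ... | x∈J , x∈A = A∌J x∈A (p─q⊆p J _ x∈J)
    non-nbr : ∀ {x y} → x ∈ J ─ nbrs A → y ∈ A → adj G y x ≡ false
    non-nbr {x} {y} x∈ y∈A with adj G y x in eq
    ... | false = refl
    ... | true  = contradiction (comprehension⁺ (hasNbrIn? A) (y , y∈A , eq)) (x∈p─q⇒x∉q J _ x∈)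
    indJ′ : Independent G ((J ─ nbrs A) ∪ A)
    indJ′ x y x∈ y∈ with x∈p∪q⁻ (J ─ nbrs A) A x∈ | x∈p∪q⁻ (J ─ nbrs A) A y∈
    ... | inj₁ x∈J | inj₁ y∈J = indJ x y (p─q⊆p J _ x∈J) (p─q⊆p J _ y∈J)
    ... | inj₁ x∈J | inj₂ y∈A = trans (sym G x y) (non-nbr x∈J y∈A)
    ... | inj₂ x∈A | inj₁ y∈J = non-nbr y∈J x∈A
    ... | inj₂ x∈A | inj₂ y∈A = indA x y x∈A y∈A

  hitting : EvenHoleFree G → ∀ {A} → Independent G A → Nonempty A → HittingSet G (A ∪ uniqueNbrs A)
  hitting ehf {A} indA A≠∅ J maxJ@(indJ , _)
    with any? (λ x → x ∈? A ∪ uniqueNbrs A ×-dec x ∈? J)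
  ... | yes hit = hit
  ... | no miss = ⊥-elim (no-thick-pair ehf _ ≤-refl indA (independent-⊆ (p∩q⊆p J (nbrs A)) indJ)
          (λ x∈A → A∌J x∈A ∘ p∩q⊆p J (nbrs A)) A≠∅ (∣A∣≤∣J∩nbrs∣ indA maxJ A∌J) thick)
    where
    A∌J : ∀ {x} → x ∈ A → x ∉ J
    A∌J x∈A x∈J = miss (_ , x∈p∪q⁺ (inj₁ x∈A) , x∈J)
    thick : Thick A (J ∩ nbrs A)
    thick {v} v∈ u with x∈p∩q⁻ J (nbrs A) v∈
    ... | v∈J , v∈N with any? (λ w → (w ∈? A ×-dec w ~? v) ×-dec ¬? (w ≟ u))
    ...   | yes other = other
    -- Now every neighbour of `v` in `A` equals `u`. As `v` has one, it lies in `uniqueNbrs A`, and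
    -- `J` is hit at `v` after all.
    ...   | no ¬other with comprehension⁻ (hasNbrIn? A) v∈N
    ...     | x , xAv = contradiction (v , x∈p∪q⁺ (inj₂ (comprehension⁺ (hasUniqueNbrIn? A)
                (x , xAv , λ y yAv → trans (≡u y yAv) (≡-sym (≡u x xAv))))) , v∈J) miss
      where
      ≡u : ∀ w → w ∈ A × w ~ v → w ≡ u
      ≡u w wAv = decidable-stable (w ≟ u) λ w≢u → ¬other (w , wAv , w≢u)

  -- A vertex with a unique neighbour in A misses one of the two parts.
  split-nbrs : ∀ {A A₁ A₂} → A₁ ⊆ A → A₂ ⊆ A → (∀ {x} → x ∈ A₁ → x ∉ A₂) →
               ∣ nbrs A₁ ∣ + ∣ nbrs A₂ ∣ + ∣ uniqueNbrs A ∣ ≤ ∣ nbrs A ∣ + ∣ nbrs A ∣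
  split-nbrs {A} {A₁} {A₂} A₁⊆A A₂⊆A disj = begin
    ∣ nbrs A₁ ∣ + ∣ nbrs A₂ ∣ + ∣ U ∣              ≡⟨ cong (_+ ∣ U ∣) (∣p∪q∣+∣p∩q∣≡∣p∣+∣q∣ (nbrs A₁) (nbrs A₂)) ⟨
    ∣ nbrs A₁ ∪ nbrs A₂ ∣ + ∣ nbrs A₁ ∩ nbrs A₂ ∣ + ∣ U ∣
      -- By inclusion-exclusion the sum is now union plus intersection. The intersection avoids `U`,
      -- so together with `∣ U ∣` it fits into a second copy of `nbrs A`.
      ≤⟨ +-mono-≤ (+-mono-≤ (p⊆q⇒∣p∣≤∣q∣ ∪⊆) (p⊆q⇒∣p∣≤∣q∣ ∩⊆)) (p⊆q⇒∣p∣≤∣q∣ U⊆) ⟩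
    ∣ nbrs A ∣ + ∣ nbrs A ─ U ∣ + ∣ nbrs A ∩ U ∣   ≡⟨ +-assoc ∣ nbrs A ∣ _ _ ⟩
    ∣ nbrs A ∣ + (∣ nbrs A ─ U ∣ + ∣ nbrs A ∩ U ∣) ≡⟨ cong (∣ nbrs A ∣ +_) (∣p─q∣+∣p∩q∣≡∣p∣ (nbrs A) U) ⟩
    ∣ nbrs A ∣ + ∣ nbrs A ∣                        ∎
    where
    open ≤-Reasoning
    U = uniqueNbrs A
    nbrs-mono : ∀ {B} → B ⊆ A → nbrs B ⊆ nbrs A
    nbrs-mono {B} B⊆A v∈ with comprehension⁻ (hasNbrIn? B) v∈
    ... | x , x∈B , xv = comprehension⁺ (hasNbrIn? A) (x , B⊆A x∈B , xv)
    ∪⊆ : nbrs A₁ ∪ nbrs A₂ ⊆ nbrs A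
    ∪⊆ = [ nbrs-mono A₁⊆A , nbrs-mono A₂⊆A ]′ ∘ x∈p∪q⁻ (nbrs A₁) (nbrs A₂)
    ∩⊆ : nbrs A₁ ∩ nbrs A₂ ⊆ nbrs A ─ U
    ∩⊆ v∈ with x∈p∩q⁻ (nbrs A₁) (nbrs A₂) v∈
    ... | v∈₁ , v∈₂ = x∈p∧x∉q⇒x∈p─q (nbrs-mono A₁⊆A v∈₁) λ v∈U →
      let x₁ , x₁∈ , x₁v   = comprehension⁻ (hasNbrIn? A₁) v∈₁
          x₂ , x₂∈ , x₂v   = comprehension⁻ (hasNbrIn? A₂) v∈₂
          _ , _ , only     = comprehension⁻ (hasUniqueNbrIn? A) v∈U
          x₁≡x₂            = trans (only x₁ (A₁⊆A x₁∈ , x₁v)) (≡-sym (only x₂ (A₂⊆A x₂∈ , x₂v)))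
      in disj x₁∈ (subst (_∈ A₂) (≡-sym x₁≡x₂) x₂∈)
    U⊆ : U ⊆ nbrs A ∩ U
    U⊆ v∈U with comprehension⁻ (hasUniqueNbrIn? A) v∈U
    ... | x , xAv , _ = x∈p∩q⁺ (comprehension⁺ (hasNbrIn? A) (x , xAv) , v∈U)

  -- Of two complementary halves, keep the one with fewer neighbours: twice its count is at most the
  -- sum bounded in `split-nbrs`.
  halve : ∀ k A → ∣ A ∣ ≡ 2 ^ suc k →
          ∃ λ A′ → A′ ⊆ A × ∣ A′ ∣ ≡ 2 ^ k × 2 * ∣ nbrs A′ ∣ + ∣ uniqueNbrs A ∣ ≤ 2 * ∣ nbrs A ∣
  halve k A ∣A∣ with subset-of-size A (2 ^ k) (subst (2 ^ k ≤_) (≡-sym ∣A∣) (m≤m+n (2 ^ k) _))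
  ... | B , B⊆A , ∣B∣ = [ (λ le → B , (λ {x} → B⊆A {x}) , ∣B∣ , bound {∣ nbrs B ∣} (+-monoʳ-≤ ∣ nbrs B ∣ le))
                        , (λ le → A ─ B , (λ {x} → p─q⊆p A B {x}) , ∣A─B∣ , bound {∣ nbrs (A ─ B) ∣} (+-monoˡ-≤ ∣ nbrs (A ─ B) ∣ le)) ]′
                        (≤-total ∣ nbrs B ∣ ∣ nbrs (A ─ B) ∣)
    where
    ∣A─B∣ : ∣ A ─ B ∣ ≡ 2 ^ k
    ∣A─B∣ = +-cancelʳ-≡ (2 ^ k) _ _ (begin
      ∣ A ─ B ∣ + 2 ^ k        ≡⟨ cong (∣ A ─ B ∣ +_) ∣B∣ ⟨
      ∣ A ─ B ∣ + ∣ B ∣        ≡⟨ cong (∣ A ─ B ∣ +_) (cong ∣_∣ A∩B≡B) ⟨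
      ∣ A ─ B ∣ + ∣ A ∩ B ∣    ≡⟨ ∣p─q∣+∣p∩q∣≡∣p∣ A B ⟩
      ∣ A ∣                    ≡⟨ ∣A∣ ⟩
      2 ^ k + (2 ^ k + 0)      ≡⟨ cong (2 ^ k +_) (+-identityʳ _) ⟩
      2 ^ k + 2 ^ k            ∎)
      where
      open ≡-Reasoning
      A∩B≡B : A ∩ B ≡ B
      A∩B≡B = ⊆-antisym (p∩q⊆q A B) (λ x∈B → x∈p∩q⁺ (B⊆A x∈B , x∈B))
    double : ∀ m → m + m ≡ 2 * m
    double m = cong (m +_) (≡-sym (+-identityʳ m))
    bound : ∀ {c} → c + c ≤ ∣ nbrs B ∣ + ∣ nbrs (A ─ B) ∣ → 2 * c + ∣ uniqueNbrs A ∣ ≤ 2 * ∣ nbrs A ∣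
    bound {c} le = begin
      2 * c + ∣ uniqueNbrs A ∣                                  ≡⟨ cong (_+ ∣ uniqueNbrs A ∣) (double c) ⟨
      c + c + ∣ uniqueNbrs A ∣                                  ≤⟨ +-monoˡ-≤ _ le ⟩
      ∣ nbrs B ∣ + ∣ nbrs (A ─ B) ∣ + ∣ uniqueNbrs A ∣
        ≤⟨ split-nbrs B⊆A (p─q⊆p A B) (λ x∈B x∈A─B → x∈p─q⇒x∉q A B x∈A─B x∈B) ⟩
      ∣ nbrs A ∣ + ∣ nbrs A ∣                                   ≡⟨ double ∣ nbrs A ∣ ⟩
      2 * ∣ nbrs A ∣                                            ∎
      where open ≤-Reasoning

  -- Of A and the set found in a half H of A, keep the one with fewer unique neighbours: if u is
  -- their minimum, then u (3 + k) = u + u (2 + k) ≤ ∣ uniqueNbrs A ∣ + 2 ∣ nbrs H ∣ ≤ 2 ∣ nbrs A ∣.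
  few-uniqueNbrs : ∀ k A → ∣ A ∣ ≡ 2 ^ k →
    ∃ λ A′ → A′ ⊆ A × Nonempty A′ × ∣ uniqueNbrs A′ ∣ * (2 + k) ≤ 2 * ∣ nbrs A ∣
  -- The `2` in `2 + k` comes from here: `uniqueNbrs A` lies in `nbrs A`, so two copies of it are
  -- affordable before any halving.
  few-uniqueNbrs zero A ∣A∣ = A , id , 0<∣p∣⇒Nonempty A (≤-reflexive (≡-sym ∣A∣)) , (begin
    ∣ uniqueNbrs A ∣ * 2 ≡⟨ *-comm ∣ uniqueNbrs A ∣ 2 ⟩
    2 * ∣ uniqueNbrs A ∣ ≤⟨ *-monoʳ-≤ 2 (p⊆q⇒∣p∣≤∣q∣ unique⊆nbrs) ⟩
    2 * ∣ nbrs A ∣       ∎)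
    where
    open ≤-Reasoning
    unique⊆nbrs : uniqueNbrs A ⊆ nbrs A
    unique⊆nbrs v∈ with comprehension⁻ (hasUniqueNbrIn? A) v∈
    ... | x , xAv , _ = comprehension⁺ (hasNbrIn? A) (x , xAv)
  few-uniqueNbrs (suc k) A ∣A∣ with halve k A ∣A∣
  ... | H , H⊆A , ∣H∣ , drop with few-uniqueNbrs k H ∣H∣
  ...   | A′ , A′⊆H , A′≠∅ , few with ≤-total ∣ uniqueNbrs A′ ∣ ∣ uniqueNbrs A ∣
  ...     | inj₁ le = A′ , H⊆A ∘ A′⊆H , A′≠∅ , (begin
    ∣ uniqueNbrs A′ ∣ * (3 + k)                      ≡⟨ *-suc ∣ uniqueNbrs A′ ∣ (2 + k) ⟩
    ∣ uniqueNbrs A′ ∣ + ∣ uniqueNbrs A′ ∣ * (2 + k)  ≤⟨ +-mono-≤ le few ⟩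
    ∣ uniqueNbrs A ∣ + 2 * ∣ nbrs H ∣                ≡⟨ +-comm ∣ uniqueNbrs A ∣ _ ⟩
    2 * ∣ nbrs H ∣ + ∣ uniqueNbrs A ∣                ≤⟨ drop ⟩
    2 * ∣ nbrs A ∣                                   ∎)
    where open ≤-Reasoning
  ...     | inj₂ ge = A , id , 0<∣p∣⇒Nonempty A (subst (0 <_) (≡-sym ∣A∣) (m^n>0 2 (suc k))) , (begin
    ∣ uniqueNbrs A ∣ * (3 + k)                       ≡⟨ *-suc ∣ uniqueNbrs A ∣ (2 + k) ⟩
    ∣ uniqueNbrs A ∣ + ∣ uniqueNbrs A ∣ * (2 + k)    ≤⟨ +-monoʳ-≤ ∣ uniqueNbrs A ∣ (≤-trans (*-monoˡ-≤ (2 + k) ge) few) ⟩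
    ∣ uniqueNbrs A ∣ + 2 * ∣ nbrs H ∣                ≡⟨ +-comm ∣ uniqueNbrs A ∣ _ ⟩
    2 * ∣ nbrs H ∣ + ∣ uniqueNbrs A ∣                ≤⟨ drop ⟩
    2 * ∣ nbrs A ∣                                   ∎)
    where open ≤-Reasoning

-- Arithmetic

-- Base 4 makes `2 ^ k` an approximate square root of `n`: its square is at most `n`, while `n`
-- stays below `2 ^ (2 * suc k)`.
log₄-bounds : ∀ n → 1 ≤ n → ∃ λ k → 4 ^ k ≤ n × n < 4 ^ suc k
log₄-bounds (suc zero)    _ = 0 , s≤s z≤n , s≤s (s≤s z≤n)
log₄-bounds (suc (suc n)) _ with log₄-bounds (suc n) (s≤s z≤n)
... | k , lo , hi with m≤n⇒m<n∨m≡n hi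
...   | inj₁ lt = k , ≤-trans lo (n≤1+n _) , lt
...   | inj₂ eq = suc k , ≤-reflexive (≡-sym eq) , subst (_< 4 ^ suc (suc k)) (≡-sym eq) (^-monoʳ-< 4 (s≤s (s≤s z≤n)) (n<1+n (suc k)))

-- Equality at `k = 3` starts the induction. The bound makes the starting set cheap:
-- `2 ^ k * (2 + 2 * k)` is at most `4 ^ k`, hence at most `n`.
2k+2≤2^k : ∀ k → 3 ≤ k → 2 + 2 * k ≤ 2 ^ k
2k+2≤2^k (suc zero)                 (s≤s ())
2k+2≤2^k (suc (suc zero))           (s≤s (s≤s ()))
2k+2≤2^k (suc (suc (suc zero)))     _ = ≤-refl
2k+2≤2^k (suc k@(suc (suc (suc _)))) _ = let ih = 2k+2≤2^k k (s≤s (s≤s (s≤s z≤n))) in begin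
  2 + 2 * suc k              ≡⟨ cong (2 +_) (*-suc 2 k) ⟩
  2 + (2 + 2 * k)            ≤⟨ +-mono-≤ (≤-trans (m≤m+n 2 _) ih) ih ⟩
  2 ^ k + 2 ^ k              ≡⟨ cong (2 ^ k +_) (+-identityʳ _) ⟨
  2 ^ suc k                  ∎
  where
  open ≤-Reasoning

4^k≡2^k*2^k : ∀ k → 4 ^ k ≡ 2 ^ k * 2 ^ k
4^k≡2^k*2^k k = trans (^-*-assoc 2 2 k) (trans (cong (2 ^_) (cong (k +_) (+-identityʳ k))) (^-distribˡ-+-* 2 k k))

-- Here `A` and `U` are cardinalities. As `n` is below `2 ^ (2 * suc k)`, it suffices that
-- `2 * suc k * t ≤ 5 * n`: `A` contributes `n`, and `U` contributes `4 * n` after `suc k` is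
-- rounded up to `2 + k`.
n^t≤2^5n : ∀ {n t A U} k → t ≤ A + U → n < 4 ^ suc k → A * (2 + 2 * k) ≤ n → U * (2 + k) ≤ 2 * n →
           n ^ t ≤ 2 ^ (5 * n)
n^t≤2^5n {n} {t} {A} {U} k t≤ n< A≤ U≤ = begin
  n ^ t                            ≤⟨ ^-monoˡ-≤ t (<⇒≤ n<) ⟩
  (4 ^ suc k) ^ t                  ≡⟨ cong (_^ t) (^-*-assoc 2 2 (suc k)) ⟩
  (2 ^ (2 * suc k)) ^ t            ≡⟨ ^-*-assoc 2 (2 * suc k) t ⟩
  2 ^ (2 * suc k * t)              ≤⟨ ^-monoʳ-≤ 2 exponent ⟩
  2 ^ (5 * n)                      ∎
  where
  open ≤-Reasoning
  U-bound : U * (2 * suc k) ≤ 4 * n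
  U-bound = begin
    U * (2 * suc k)        ≤⟨ *-monoʳ-≤ U (*-monoʳ-≤ 2 (n≤1+n (suc k))) ⟩
    U * (2 * (2 + k))      ≡⟨ *-assoc U 2 (2 + k) ⟨
    U * 2 * (2 + k)        ≡⟨ cong (_* (2 + k)) (*-comm U 2) ⟩
    2 * U * (2 + k)        ≡⟨ *-assoc 2 U (2 + k) ⟩
    2 * (U * (2 + k))      ≤⟨ *-monoʳ-≤ 2 U≤ ⟩
    2 * (2 * n)            ≡⟨ *-assoc 2 2 n ⟨
    4 * n                  ∎
  exponent : 2 * suc k * t ≤ 5 * n
  exponent = begin
    2 * suc k * t                          ≤⟨ *-monoʳ-≤ (2 * suc k) t≤ ⟩
    2 * suc k * (A + U)                    ≡⟨ *-comm (2 * suc k) (A + U) ⟩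
    (A + U) * (2 * suc k)                  ≡⟨ *-distribʳ-+ (2 * suc k) A U ⟩
    A * (2 * suc k) + U * (2 * suc k)      ≡⟨ cong (λ m → A * m + U * (2 * suc k)) (*-suc 2 k) ⟩
    A * (2 + 2 * k) + U * (2 * suc k)      ≤⟨ +-mono-≤ A≤ U-bound ⟩
    n + 4 * n                              ∎

-- The density `c` is the fraction `suc p / suc q`; no irrational `c` can equal `a / n`. The final
-- inequality is `∣ T ∣ log n ≤ 5n`, exponentiated to base 2.
theorem1p3 : (p q : ℕ) → ∃ λ (N : ℕ) → ∀ (n : ℕ) → N ≤ n →
    (G : Graph n) → EvenHoleFree G → (a : ℕ) → IndependenceNumber G a →
    a * suc q ≡ suc p * n →
    Σ (Subset n) λ T → HittingSet G T × (n ^ ∣ T ∣ ≤ 2 ^ (5 * n))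
-- This threshold forces `3 + q ≤ k`: the `3` serves `2k+2≤2^k`, and the `q` serves `suc q ≤ 2 ^ k`.
theorem1p3 p q = 4 ^ (3 + q) , main
  where
  main : ∀ n → 4 ^ (3 + q) ≤ n → (G : Graph n) → EvenHoleFree G → ∀ a → IndependenceNumber G a →
         a * suc q ≡ suc p * n → Σ (Subset n) λ T → HittingSet G T × (n ^ ∣ T ∣ ≤ 2 ^ (5 * n))
  main n N≤n G ehf a (I , (indI , _) , ∣I∣≡a) a≡cn
    with log₄-bounds n (≤-trans (m^n>0 4 (3 + q)) N≤n)
  ... | k , lo , hi = result
    where
    open ≤-Reasoning
    3+q≤k : 3 + q ≤ k
    3+q≤k = ≮⇒≥ λ k< → <⇒≱ hi (≤-trans (^-monoʳ-≤ 4 k<) N≤n)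
    k-large : 2 + 2 * k ≤ 2 ^ k
    k-large = 2k+2≤2^k k (≤-trans (m≤m+n 3 q) 3+q≤k)
    2^k*m≤n : ∀ {m} → m ≤ 2 ^ k → 2 ^ k * m ≤ n
    2^k*m≤n {m} le = begin
      2 ^ k * m      ≤⟨ *-monoʳ-≤ (2 ^ k) le ⟩
      2 ^ k * 2 ^ k  ≡⟨ 4^k≡2^k*2^k k ⟨
      4 ^ k          ≤⟨ lo ⟩
      n              ∎
    1+q≤2^k : suc q ≤ 2 ^ k
    1+q≤2^k = begin
      suc q          ≤⟨ m≤n+m (suc q) 2 ⟩
      2 + suc q      ≡⟨ +-suc 2 q ⟩
      3 + q          ≤⟨ 3+q≤k ⟩
      k              ≤⟨ m≤m+n k _ ⟩
      2 * k          ≤⟨ m≤n+m (2 * k) 2 ⟩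
      2 + 2 * k      ≤⟨ k-large ⟩
      2 ^ k          ∎
    2^k≤∣I∣ : 2 ^ k ≤ ∣ I ∣
    -- The density enters only here: `c` is at least `1 / suc q`, so `I` has room for `2 ^ k`
    -- vertices once `2 ^ k * suc q ≤ n`.
    2^k≤∣I∣ = subst (2 ^ k ≤_) (≡-sym ∣I∣≡a) (*-cancelʳ-≤ (2 ^ k) a (suc q) (begin
      2 ^ k * suc q  ≤⟨ 2^k*m≤n 1+q≤2^k ⟩
      n              ≤⟨ m≤m+n n (p * n) ⟩
      suc p * n      ≡⟨ a≡cn ⟨
      a * suc q      ∎))
    result : Σ (Subset n) λ T → HittingSet G T × (n ^ ∣ T ∣ ≤ 2 ^ (5 * n))
    result with subset-of-size I (2 ^ k) 2^k≤∣I∣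
    ... | A , A⊆I , ∣A∣ with few-uniqueNbrs G k A ∣A∣
    ...   | A′ , A′⊆A , A′≠∅ , few =
      A′ ∪ uniqueNbrs G A′ ,
      hitting G ehf (independent-⊆ G (A⊆I ∘ A′⊆A) indI) A′≠∅ ,
      n^t≤2^5n {U = ∣ uniqueNbrs G A′ ∣} k
        (≤-trans (∣p∪q∣≤∣p∣+∣q∣ A′ (uniqueNbrs G A′))
                 (+-monoˡ-≤ _ (subst (∣ A′ ∣ ≤_) ∣A∣ (p⊆q⇒∣p∣≤∣q∣ A′⊆A))))
        hi (2^k*m≤n k-large)
        (≤-trans few (*-monoʳ-≤ 2 (∣p∣≤n (nbrs G A))))
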